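{- Let $f(n)$ and $g(n)$ be functions. Then: (1) If $f\in a(K,g)$ then $f\in\Theta(g)$. (2) If $f\in\Theta(g)$ then it is not necessary to have $f\in a(K,g)$. (3) Therefore, the relation $a(\cdot)$ is a subset of the relation $\Theta(\cdot)$.
   Context: Definition ("Almost"): a function $f(n)$ is almost $g(n)$, written $f\in a(K,g)$, if and only if the limit $$\lim_{n\to\infty}\frac{f(n)}{g(n)}=K,\qquad 0<K<\infty,$$ exists. Definition (Big-Theta): for functions $f(n)$ and $g(n)$, one writes $f\in\Theta(g)$ when $$\exists k_1>0\ \exists k_2>0\ \exists n_0\ \forall n>n_0:\quad g(n)\cdot k_1\leq f(n)\leq g(n)\cdot k_2.$$
   Formalization: The function g is required to be positive for all large n; with sign changes (1) fails, e.g. g(n)=(-1)^n, f(n)=(-1)^n+1/(n+1), where f/g tends to 1 but f is not in Θ(g). Eventually negative g follows by negating f and g. -}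

module Defs where

open import Data.Nat.Base as ℕ using (ℕ)
import Data.Nat.Properties as ℕₚ
open import Data.Product.Base using (Σ; Σ-syntax; ∃-syntax; _×_; _,_)
open import Data.Rational.Base as ℚ using (ℚ; 0ℚ; 1ℚ; ½)
import Data.Rational.Properties as ℚₚ
open import Data.Rational.Solver using (module +-*-Solver)
open import Data.Sum.Base using (_⊎_; inj₁; inj₂)
open import Level using (0ℓ)
open import Relation.Binary.Core using (REL)
open import Relation.Binary.PropositionalEquality
open import Relation.Nullary using (yes; no; contradiction)

private
  variable
    p q r s : ℚ

  open +-*-Solver using (solve; con; _:+_; _:*_; _:-_; :-_; _:=_)

  opaque
    *-mono-≤ : 0ℚ ℚ.≤ r → 0ℚ ℚ.≤ q → p ℚ.≤ q → r ℚ.≤ s → p ℚ.* r ℚ.≤ q ℚ.* s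
    *-mono-≤ {r} {q} 0≤r 0≤q p≤q r≤s = ℚₚ.≤-trans
      (ℚₚ.*-monoʳ-≤-nonNeg r {{ℚ.nonNegative 0≤r}} p≤q)
      (ℚₚ.*-monoˡ-≤-nonNeg q {{ℚ.nonNegative 0≤q}} r≤s)

    *-pos : 0ℚ ℚ.< p → 0ℚ ℚ.< q → 0ℚ ℚ.< p ℚ.* q
    *-pos {p} {q} 0<p 0<q = ℚₚ.positive⁻¹ (p ℚ.* q)
      {{ℚₚ.pos*pos⇒pos p {{ℚ.positive 0<p}} q {{ℚ.positive 0<q}}}}

    0<½ : 0ℚ ℚ.< ½
    0<½ = ℚₚ.positive⁻¹ ½

    0<1 : 0ℚ ℚ.< 1ℚ
    0<1 = ℚₚ.positive⁻¹ 1ℚ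

    ∣p*q∣≤ : ∀ p q r s → ℚ.∣ p ∣ ℚ.≤ r → ℚ.∣ q ∣ ℚ.≤ s → ℚ.∣ p ℚ.* q ∣ ℚ.≤ r ℚ.* s
    ∣p*q∣≤ p q r s ∣p∣≤r ∣q∣≤s = subst (ℚ._≤ r ℚ.* s) (sym (ℚₚ.∣p*q∣≡∣p∣*∣q∣ p q))
      (*-mono-≤ {r = ℚ.∣ q ∣} {q = r} {p = ℚ.∣ p ∣} {s = s} (ℚₚ.0≤∣p∣ q)
        (ℚₚ.≤-trans (ℚₚ.0≤∣p∣ p) ∣p∣≤r) ∣p∣≤r ∣q∣≤s)

    ½-< : 0ℚ ℚ.< p → ½ ℚ.* p ℚ.< p
    ½-< {p} 0<p = subst₂ ℚ._<_ (ℚₚ.+-identityʳ (½ ℚ.* p)) halves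
      (ℚₚ.+-monoʳ-< (½ ℚ.* p) (*-pos 0<½ 0<p))
      where
      halves : ½ ℚ.* p ℚ.+ ½ ℚ.* p ≡ p
      halves = solve 1 (λ x → con ½ :* x :+ con ½ :* x := x) refl p

    p≤∣p∣ : ∀ p → p ℚ.≤ ℚ.∣ p ∣
    p≤∣p∣ p with ℚₚ.≤-total 0ℚ p
    ... | inj₁ 0≤p = ℚₚ.≤-reflexive (sym (ℚₚ.0≤p⇒∣p∣≡p 0≤p))
    ... | inj₂ p≤0 = ℚₚ.≤-trans p≤0 (ℚₚ.0≤∣p∣ p)

    ∣p∣≤ : p ℚ.≤ q → ℚ.- p ℚ.≤ q → ℚ.∣ p ∣ ℚ.≤ q
    ∣p∣≤ {p} p≤q -p≤q with ℚₚ.∣p∣≡p∨∣p∣≡-p p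
    ... | inj₁ eq = subst (ℚ._≤ _) (sym eq) p≤q
    ... | inj₂ eq = subst (ℚ._≤ _) (sym eq) -p≤q

    ∣p∣≤∣q∣+∣p-q∣ : ∀ p q → ℚ.∣ p ∣ ℚ.≤ ℚ.∣ q ∣ ℚ.+ ℚ.∣ p ℚ.- q ∣
    ∣p∣≤∣q∣+∣p-q∣ p q = subst (λ z → ℚ.∣ z ∣ ℚ.≤ ℚ.∣ q ∣ ℚ.+ ℚ.∣ p ℚ.- q ∣)
      (solve 2 (λ x y → y :+ (x :- y) := x) refl p q)
      (ℚₚ.∣p+q∣≤∣p∣+∣q∣ q (p ℚ.- q))

    ∣p-q∣≡∣q-p∣ : ∀ p q → ℚ.∣ p ℚ.- q ∣ ≡ ℚ.∣ q ℚ.- p ∣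
    ∣p-q∣≡∣q-p∣ p q = trans (sym (ℚₚ.∣-p∣≡∣p∣ (p ℚ.- q)))
      (cong ℚ.∣_∣ (solve 2 (λ x y → :- (x :- y) := y :- x) refl p q))

    p-q≡-[q-p] : ∀ p q → p ℚ.- q ≡ ℚ.- (q ℚ.- p)
    p-q≡-[q-p] = solve 2 (λ x y → x :- y := :- (y :- x)) refl

    ∣∣p∣-∣q∣∣≤∣p-q∣ : ∀ p q → ℚ.∣ ℚ.∣ p ∣ ℚ.- ℚ.∣ q ∣ ∣ ℚ.≤ ℚ.∣ p ℚ.- q ∣
    ∣∣p∣-∣q∣∣≤∣p-q∣ p q = ∣p∣≤ (below (∣p∣≤∣q∣+∣p-q∣ p q))
      (subst (ℚ._≤ ℚ.∣ p ℚ.- q ∣) (p-q≡-[q-p] ℚ.∣ q ∣ ℚ.∣ p ∣)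
        (below (subst (λ z → ℚ.∣ q ∣ ℚ.≤ ℚ.∣ p ∣ ℚ.+ z) (∣p-q∣≡∣q-p∣ q p)
          (∣p∣≤∣q∣+∣p-q∣ q p))))
      where
      below : ∀ {a b c} → a ℚ.≤ b ℚ.+ c → a ℚ.- b ℚ.≤ c
      below {a} {b} {c} a≤b+c = subst (a ℚ.- b ℚ.≤_)
        (solve 2 (λ y z → (y :+ z) :- y := z) refl b c)
        (ℚₚ.+-monoˡ-≤ (ℚ.- b) a≤b+c)

    +-difference : ∀ a b c d →
      (a ℚ.+ b) ℚ.- (c ℚ.+ d) ≡ (a ℚ.- c) ℚ.+ (b ℚ.- d)
    +-difference = solve 4 (λ a b c d →
      (a :+ b) :- (c :+ d) := (a :- c) :+ (b :- d)) refl

    *-difference : ∀ a b c d →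
      a ℚ.* b ℚ.- c ℚ.* d ≡ a ℚ.* (b ℚ.- d) ℚ.+ d ℚ.* (a ℚ.- c)
    *-difference = solve 4 (λ a b c d →
      a :* b :- c :* d := a :* (b :- d) :+ d :* (a :- c)) refl

    recip-difference : ∀ a b a′ b′ →
      a′ ℚ.* (b ℚ.* b′) ℚ.- b′ ℚ.* (a ℚ.* a′) ≡ (a′ ℚ.* b′) ℚ.* (b ℚ.- a)
    recip-difference = solve 4 (λ a b a′ b′ →
      a′ :* (b :* b′) :- b′ :* (a :* a′) := (a′ :* b′) :* (b :- a)) refl

    product-close : ∀ a b c d A B ε →
      ℚ.∣ a ∣ ℚ.≤ A → ℚ.∣ d ∣ ℚ.≤ B → ℚ.∣ a ℚ.- c ∣ ℚ.< ε → ℚ.∣ b ℚ.- d ∣ ℚ.< ε →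
      ℚ.∣ a ℚ.* b ℚ.- c ℚ.* d ∣ ℚ.≤ (A ℚ.+ B) ℚ.* ε
    product-close a b c d A B ε ∣a∣≤A ∣d∣≤B a-c<ε b-d<ε = begin
      ℚ.∣ a ℚ.* b ℚ.- c ℚ.* d ∣
        ≡⟨ cong ℚ.∣_∣ (*-difference a b c d) ⟩
      ℚ.∣ a ℚ.* (b ℚ.- d) ℚ.+ d ℚ.* (a ℚ.- c) ∣
        ≤⟨ ℚₚ.∣p+q∣≤∣p∣+∣q∣ (a ℚ.* (b ℚ.- d)) (d ℚ.* (a ℚ.- c)) ⟩
      ℚ.∣ a ℚ.* (b ℚ.- d) ∣ ℚ.+ ℚ.∣ d ℚ.* (a ℚ.- c) ∣
        ≤⟨ ℚₚ.+-mono-≤ (∣p*q∣≤ a (b ℚ.- d) A ε ∣a∣≤A (ℚₚ.<⇒≤ b-d<ε))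
                       (∣p*q∣≤ d (a ℚ.- c) B ε ∣d∣≤B (ℚₚ.<⇒≤ a-c<ε)) ⟩
      A ℚ.* ε ℚ.+ B ℚ.* ε
        ≡⟨ ℚₚ.*-distribʳ-+ ε A B ⟨
      (A ℚ.+ B) ℚ.* ε ∎
      where open ℚₚ.≤-Reasoning

recip : ℚ → ℚ
recip q with q ℚₚ.≟ 0ℚ
... | yes _  = 0ℚ
... | no q≢0 = (ℚ.1/ q) {{ℚ.≢-nonZero q≢0}}

opaque
  recip-inverse : q ≢ 0ℚ → q ℚ.* recip q ≡ 1ℚ
  recip-inverse {q} q≢0 with q ℚₚ.≟ 0ℚ
  ... | yes q≡0 = contradiction q≡0 q≢0
  ... | no q≢0′ = ℚₚ.*-inverseʳ q {{ℚ.≢-nonZero q≢0′}}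

  recip-pos : 0ℚ ℚ.< q → 0ℚ ℚ.< recip q
  recip-pos {q} 0<q with q ℚₚ.≟ 0ℚ
  ... | yes q≡0 = contradiction (sym q≡0) (ℚₚ.<⇒≢ 0<q)
  ... | no q≢0  = ℚₚ.positive⁻¹ _ {{ℚₚ.1/pos⇒pos q {{ℚ.positive 0<q}}}}

-- Real numbers, as Cauchy sequences of rationals.  Sequences
-- representing the same real are not identified; every relation below is
-- invariant under that equivalence.  Moduli of convergence are opaque so
-- that normalisation never enters them.

IsCauchy : (ℕ → ℚ) → Set
IsCauchy x = ∀ ε → 0ℚ ℚ.< ε →
  ∃[ N ] ∀ m n → N ℕ.≤ m → N ℕ.≤ n → ℚ.∣ x m ℚ.- x n ∣ ℚ.< ε

record ℝ : Set where
  constructor real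
  field
    seq      : ℕ → ℚ
    isCauchy : IsCauchy seq

open ℝ public

private
  variable
    x y : ℕ → ℚ

  opaque
    scaled : ∀ C → 0ℚ ℚ.< C →
      (∀ ε → 0ℚ ℚ.< ε →
        ∃[ N ] ∀ m n → N ℕ.≤ m → N ℕ.≤ n → ℚ.∣ x m ℚ.- x n ∣ ℚ.≤ C ℚ.* ε) →
      IsCauchy x
    scaled C 0<C bound ε 0<ε
      with bound (recip C ℚ.* (½ ℚ.* ε)) (*-pos (recip-pos 0<C) (*-pos 0<½ 0<ε))
    ... | N , close = N , λ m n N≤m N≤n →
      ℚₚ.≤-<-trans (ℚₚ.≤-trans (close m n N≤m N≤n) (ℚₚ.≤-reflexive cancel)) (½-< 0<ε)
      where
      cancel : C ℚ.* (recip C ℚ.* (½ ℚ.* ε)) ≡ ½ ℚ.* ε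
      cancel = trans (sym (ℚₚ.*-assoc C (recip C) (½ ℚ.* ε)))
        (trans (cong (ℚ._* (½ ℚ.* ε)) (recip-inverse (λ C≡0 → ℚₚ.<⇒≢ 0<C (sym C≡0))))
          (ℚₚ.*-identityˡ (½ ℚ.* ε)))

    const-cauchy : ∀ q → IsCauchy (λ _ → q)
    const-cauchy q ε 0<ε = 0 , λ _ _ _ _ →
      subst (ℚ._< ε) (cong ℚ.∣_∣ (sym (ℚₚ.+-inverseʳ q))) 0<ε

    neg-cauchy : IsCauchy x → IsCauchy (λ n → ℚ.- x n)
    neg-cauchy {x} cx ε 0<ε with cx ε 0<ε
    ... | N , close = N , λ m n N≤m N≤n →
      subst (ℚ._< ε) (eq (x m) (x n)) (close m n N≤m N≤n)
      where
      eq : ∀ p q → ℚ.∣ p ℚ.- q ∣ ≡ ℚ.∣ ℚ.- p ℚ.- (ℚ.- q) ∣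
      eq p q = trans (sym (ℚₚ.∣-p∣≡∣p∣ (p ℚ.- q)))
        (cong ℚ.∣_∣ (solve 2 (λ x y → :- (x :- y) := :- x :- (:- y)) refl p q))

    abs-cauchy : IsCauchy x → IsCauchy (λ n → ℚ.∣ x n ∣)
    abs-cauchy {x} cx ε 0<ε with cx ε 0<ε
    ... | N , close = N , λ m n N≤m N≤n →
      ℚₚ.≤-<-trans (∣∣p∣-∣q∣∣≤∣p-q∣ (x m) (x n)) (close m n N≤m N≤n)

    +-cauchy : IsCauchy x → IsCauchy y → IsCauchy (λ n → x n ℚ.+ y n)
    +-cauchy {x} {y} cx cy = scaled {x = λ n → x n ℚ.+ y n} (1ℚ ℚ.+ 1ℚ) (ℚₚ.positive⁻¹ _) bound
      where
      bound : ∀ ε → 0ℚ ℚ.< ε → ∃[ N ] ∀ m n → N ℕ.≤ m → N ℕ.≤ n →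
        ℚ.∣ (x m ℚ.+ y m) ℚ.- (x n ℚ.+ y n) ∣ ℚ.≤ (1ℚ ℚ.+ 1ℚ) ℚ.* ε
      bound ε 0<ε with cx ε 0<ε | cy ε 0<ε
      ... | M , closeˣ | N , closeʸ = M ℕ.⊔ N , λ m n K≤m K≤n → begin
        ℚ.∣ (x m ℚ.+ y m) ℚ.- (x n ℚ.+ y n) ∣
          ≡⟨ cong ℚ.∣_∣ (+-difference (x m) (y m) (x n) (y n)) ⟩
        ℚ.∣ (x m ℚ.- x n) ℚ.+ (y m ℚ.- y n) ∣
          ≤⟨ ℚₚ.∣p+q∣≤∣p∣+∣q∣ (x m ℚ.- x n) (y m ℚ.- y n) ⟩
        ℚ.∣ x m ℚ.- x n ∣ ℚ.+ ℚ.∣ y m ℚ.- y n ∣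
          ≤⟨ ℚₚ.+-mono-≤
               (ℚₚ.<⇒≤ (closeˣ m n (ℕₚ.m⊔n≤o⇒m≤o M N K≤m) (ℕₚ.m⊔n≤o⇒m≤o M N K≤n)))
               (ℚₚ.<⇒≤ (closeʸ m n (ℕₚ.m⊔n≤o⇒n≤o M N K≤m) (ℕₚ.m⊔n≤o⇒n≤o M N K≤n))) ⟩
        ε ℚ.+ ε
          ≡⟨ solve 1 (λ e → e :+ e := (con 1ℚ :+ con 1ℚ) :* e) refl ε ⟩
        (1ℚ ℚ.+ 1ℚ) ℚ.* ε ∎
        where open ℚₚ.≤-Reasoning

    bounded : IsCauchy x →
      ∃[ B ] 0ℚ ℚ.< B × ∃[ N ] ∀ n → N ℕ.≤ n → ℚ.∣ x n ∣ ℚ.≤ B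
    bounded {x} cx with cx 1ℚ 0<1
    ... | N , close = ℚ.∣ x N ∣ ℚ.+ 1ℚ
      , ℚₚ.+-mono-≤-< (ℚₚ.0≤∣p∣ (x N)) 0<1
      , N
      , λ n N≤n → ℚₚ.≤-trans (∣p∣≤∣q∣+∣p-q∣ (x n) (x N))
          (ℚₚ.+-monoʳ-≤ ℚ.∣ x N ∣ (ℚₚ.<⇒≤ (close n N N≤n ℕₚ.≤-refl)))

  opaque
    *-cauchy : IsCauchy x → IsCauchy y → IsCauchy (λ n → x n ℚ.* y n)
    *-cauchy {x} {y} cx cy with bounded cx | bounded cy
    ... | A , 0<A , Nᴬ , ∣x∣≤A | B , 0<B , Nᴮ , ∣y∣≤B =
      scaled {x = λ n → x n ℚ.* y n} (A ℚ.+ B) (ℚₚ.+-mono-< 0<A 0<B) bound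
      where
      bound : ∀ ε → 0ℚ ℚ.< ε → ∃[ N ] ∀ m n → N ℕ.≤ m → N ℕ.≤ n →
        ℚ.∣ x m ℚ.* y m ℚ.- x n ℚ.* y n ∣ ℚ.≤ (A ℚ.+ B) ℚ.* ε
      bound ε 0<ε with cx ε 0<ε | cy ε 0<ε
      ... | M , closeˣ | N , closeʸ = (M ℕ.⊔ N) ℕ.⊔ (Nᴬ ℕ.⊔ Nᴮ) , λ m n K≤m K≤n →
        let MN≤m = ℕₚ.m⊔n≤o⇒m≤o (M ℕ.⊔ N) (Nᴬ ℕ.⊔ Nᴮ) K≤m
            MN≤n = ℕₚ.m⊔n≤o⇒m≤o (M ℕ.⊔ N) (Nᴬ ℕ.⊔ Nᴮ) K≤n
            AB≤m = ℕₚ.m⊔n≤o⇒n≤o (M ℕ.⊔ N) (Nᴬ ℕ.⊔ Nᴮ) K≤m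
            AB≤n = ℕₚ.m⊔n≤o⇒n≤o (M ℕ.⊔ N) (Nᴬ ℕ.⊔ Nᴮ) K≤n
        in product-close (x m) (y m) (x n) (y n) A B ε
          (∣x∣≤A m (ℕₚ.m⊔n≤o⇒m≤o Nᴬ Nᴮ AB≤m))
          (∣y∣≤B n (ℕₚ.m⊔n≤o⇒n≤o Nᴬ Nᴮ AB≤n))
          (closeˣ m n (ℕₚ.m⊔n≤o⇒m≤o M N MN≤m) (ℕₚ.m⊔n≤o⇒m≤o M N MN≤n))
          (closeʸ m n (ℕₚ.m⊔n≤o⇒n≤o M N MN≤m) (ℕₚ.m⊔n≤o⇒n≤o M N MN≤n))

  opaque
    recip-cauchy : ∀ δ → 0ℚ ℚ.< δ → ∃[ N ] (∀ n → N ℕ.≤ n → δ ℚ.≤ ℚ.∣ x n ∣) →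
      IsCauchy x → IsCauchy (λ n → recip (x n))
    recip-cauchy {x} δ 0<δ (N , δ≤) cx =
      scaled {x = λ n → recip (x n)} (C ℚ.* C) (*-pos 0<C 0<C) bound
      where
      C : ℚ
      C = recip δ

      0<C : 0ℚ ℚ.< C
      0<C = recip-pos 0<δ

      nonzero : ∀ p → δ ℚ.≤ ℚ.∣ p ∣ → p ≢ 0ℚ
      nonzero p δ≤0 refl = ℚₚ.<-irrefl refl (ℚₚ.<-≤-trans 0<δ δ≤0)

      recip≤ : ∀ p → δ ℚ.≤ ℚ.∣ p ∣ → ℚ.∣ recip p ∣ ℚ.≤ C
      recip≤ p δ≤∣p∣ = ℚₚ.*-cancelˡ-≤-pos δ {{ℚ.positive 0<δ}} (begin
        δ ℚ.* ℚ.∣ recip p ∣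
          ≤⟨ ℚₚ.*-monoʳ-≤-nonNeg ℚ.∣ recip p ∣ {{ℚₚ.∣-∣-nonNeg (recip p)}} δ≤∣p∣ ⟩
        ℚ.∣ p ∣ ℚ.* ℚ.∣ recip p ∣
          ≡⟨ ℚₚ.∣p*q∣≡∣p∣*∣q∣ p (recip p) ⟨
        ℚ.∣ p ℚ.* recip p ∣
          ≡⟨ cong ℚ.∣_∣ (recip-inverse (nonzero p δ≤∣p∣)) ⟩
        1ℚ
          ≡⟨ recip-inverse (λ δ≡0 → ℚₚ.<⇒≢ 0<δ (sym δ≡0)) ⟨
        δ ℚ.* C ∎)
        where open ℚₚ.≤-Reasoning

      difference : p ≢ 0ℚ → q ≢ 0ℚ →
        recip p ℚ.- recip q ≡ (recip p ℚ.* recip q) ℚ.* (q ℚ.- p)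
      difference {p} {q} p≢0 q≢0 = begin
        recip p ℚ.- recip q
          ≡⟨ cong₂ ℚ._-_ (ℚₚ.*-identityʳ (recip p)) (ℚₚ.*-identityʳ (recip q)) ⟨
        recip p ℚ.* 1ℚ ℚ.- recip q ℚ.* 1ℚ
          ≡⟨ cong₂ (λ u v → recip p ℚ.* u ℚ.- recip q ℚ.* v)
               (recip-inverse q≢0) (recip-inverse p≢0) ⟨
        recip p ℚ.* (q ℚ.* recip q) ℚ.- recip q ℚ.* (p ℚ.* recip p)
          ≡⟨ recip-difference p q (recip p) (recip q) ⟩
        (recip p ℚ.* recip q) ℚ.* (q ℚ.- p) ∎
        where open ≡-Reasoning

      bound : ∀ ε → 0ℚ ℚ.< ε → ∃[ K ] ∀ m n → K ℕ.≤ m → K ℕ.≤ n →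
        ℚ.∣ recip (x m) ℚ.- recip (x n) ∣ ℚ.≤ (C ℚ.* C) ℚ.* ε
      bound ε 0<ε with cx ε 0<ε
      ... | M , close = M ℕ.⊔ N , λ m n K≤m K≤n →
        let δ≤xₘ = δ≤ m (ℕₚ.m⊔n≤o⇒n≤o M N K≤m)
            δ≤xₙ = δ≤ n (ℕₚ.m⊔n≤o⇒n≤o M N K≤n)
        in begin
        ℚ.∣ recip (x m) ℚ.- recip (x n) ∣
          ≡⟨ cong ℚ.∣_∣ (difference (nonzero (x m) δ≤xₘ) (nonzero (x n) δ≤xₙ)) ⟩
        ℚ.∣ (recip (x m) ℚ.* recip (x n)) ℚ.* (x n ℚ.- x m) ∣
          ≤⟨ ∣p*q∣≤ (recip (x m) ℚ.* recip (x n)) (x n ℚ.- x m) (C ℚ.* C) ε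
               (∣p*q∣≤ (recip (x m)) (recip (x n)) C C (recip≤ (x m) δ≤xₘ) (recip≤ (x n) δ≤xₙ))
               (ℚₚ.<⇒≤ (close n m (ℕₚ.m⊔n≤o⇒m≤o M N K≤n) (ℕₚ.m⊔n≤o⇒m≤o M N K≤m))) ⟩
        (C ℚ.* C) ℚ.* ε ∎
        where open ℚₚ.≤-Reasoning

infix 4 _<_ _≤_ _#_

_<_ : ℝ → ℝ → Set
x < y = ∃[ δ ] 0ℚ ℚ.< δ × ∃[ N ] ∀ n → N ℕ.≤ n → seq x n ℚ.+ δ ℚ.≤ seq y n

_≤_ : ℝ → ℝ → Set
x ≤ y = ∀ ε → 0ℚ ℚ.< ε → ∃[ N ] ∀ n → N ℕ.≤ n → seq x n ℚ.≤ seq y n ℚ.+ ε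

-- The constructive form of x ≠ y.

_#_ : ℝ → ℝ → Set
x # y = x < y ⊎ y < x

fromℚ : ℚ → ℝ
fromℚ q = real (λ _ → q) (const-cauchy q)

0ℝ : ℝ
0ℝ = fromℚ 0ℚ

infixl 6 _+_ _-_
infixl 7 _*_ _÷_[_]
infix  8 -_

_+_ : ℝ → ℝ → ℝ
x + y = real (λ n → seq x n ℚ.+ seq y n) (+-cauchy {seq x} {seq y} (isCauchy x) (isCauchy y))

_*_ : ℝ → ℝ → ℝ
x * y = real (λ n → seq x n ℚ.* seq y n) (*-cauchy {seq x} {seq y} (isCauchy x) (isCauchy y))

-_ : ℝ → ℝ
- x = real (λ n → ℚ.- seq x n) (neg-cauchy {seq x} (isCauchy x))

_-_ : ℝ → ℝ → ℝ
x - y = x + (- y)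

∣_∣ : ℝ → ℝ
∣ x ∣ = real (λ n → ℚ.∣ seq x n ∣) (abs-cauchy {seq x} (isCauchy x))

private
  opaque
    away-from-0 : ∀ x → x # 0ℝ →
      ∃[ δ ] 0ℚ ℚ.< δ × ∃[ N ] ∀ n → N ℕ.≤ n → δ ℚ.≤ ℚ.∣ seq x n ∣
    away-from-0 x (inj₁ (δ , 0<δ , N , x+δ≤0)) = δ , 0<δ , N , λ n N≤n →
      ℚₚ.≤-trans
        (subst₂ ℚ._≤_
          (solve 2 (λ a d → (a :+ d) :- a := d) refl (seq x n) δ)
          (ℚₚ.+-identityˡ (ℚ.- seq x n))
          (ℚₚ.+-monoˡ-≤ (ℚ.- seq x n) (x+δ≤0 n N≤n)))
        (subst (ℚ.- seq x n ℚ.≤_) (ℚₚ.∣-p∣≡∣p∣ (seq x n)) (p≤∣p∣ (ℚ.- seq x n)))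
    away-from-0 x (inj₂ (δ , 0<δ , N , δ≤x)) = δ , 0<δ , N , λ n N≤n →
      ℚₚ.≤-trans (subst (ℚ._≤ seq x n) (ℚₚ.+-identityˡ δ) (δ≤x n N≤n)) (p≤∣p∣ (seq x n))

-- A nonzero real may still have finitely many zero terms; these are the
-- ones at which the value recip 0 = 0 is used.

inverse : (x : ℝ) → x # 0ℝ → ℝ
inverse x x#0 = real (λ n → recip (seq x n))
  (let δ , 0<δ , far = away-from-0 x x#0 in recip-cauchy {seq x} δ 0<δ far (isCauchy x))

_÷_[_] : (x y : ℝ) → y # 0ℝ → ℝ
x ÷ y [ y#0 ] = x * inverse y y#0

-- lim f(n)/g(n) = K includes that the quotient is defined for all large n.

_∈a[_,_] : (ℕ → ℝ) → ℝ → (ℕ → ℝ) → Set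
f ∈a[ K , g ] = 0ℝ < K ×
  (∀ ε → 0ℝ < ε → ∃[ n₀ ] ∀ n → n ℕ.> n₀ →
    Σ[ gₙ#0 ∈ g n # 0ℝ ] ∣ f n ÷ g n [ gₙ#0 ] - K ∣ < ε)

_∈Θ[_] : (ℕ → ℝ) → (ℕ → ℝ) → Set
f ∈Θ[ g ] = ∃[ k₁ ] 0ℝ < k₁ × ∃[ k₂ ] 0ℝ < k₂ × ∃[ n₀ ] ∀ n → n ℕ.> n₀ →
  g n * k₁ ≤ f n × f n ≤ g n * k₂

-- Comparison functions g are positive for large n, as usual in
-- asymptotic analysis.  If g may change sign infinitely often, f ∈ a(K, g)
-- does not imply f ∈ Θ(g): take g(n) = (-1)ⁿ and f(n) = (-1)ⁿ + 1/(n+1).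

EventuallyPositive : (ℕ → ℝ) → Set
EventuallyPositive g = ∃[ n₀ ] ∀ n → n ℕ.> n₀ → 0ℝ < g n

ComparisonFunction : Set
ComparisonFunction = Σ[ g ∈ (ℕ → ℝ) ] EventuallyPositive g

-- As a relation between f and g, a(·) leaves the constant K unspecified.

Almost : REL (ℕ → ℝ) ComparisonFunction 0ℓ
Almost f (g , _) = ∃[ K ] f ∈a[ K , g ]

BigTheta : REL (ℕ → ℝ) ComparisonFunction 0ℓ
BigTheta f (g , _) = f ∈Θ[ g ]

{-# OPTIONS --safe #-}
-- If 0 < δ ≤ K, then f(n) / g(n) is eventually within ε = δ / 2 of K, so that
-- k₁ = K − ε and k₂ = K + ε are positive and witness f ∈ Θ(g).  Conversely
-- f = 1, 2, 1, 2, … is in Θ(1), but consecutive terms of f differ by 1 and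
-- hence cannot both be within 1/2 of a limit.

module Submission where

open import Defs
open import Data.Nat.Base as ℕ using (ℕ; suc)
import Data.Nat.Properties as ℕₚ
open import Data.Product.Base using (∃-syntax; _×_; _,_)
open import Data.Rational.Base as ℚ using (ℚ; 0ℚ; 1ℚ; ½)
import Data.Rational.Properties as ℚₚ
open import Data.Rational.Solver using (module +-*-Solver)
open import Data.Sum.Base using (inj₁; inj₂)
open import Function.Base using (_∘_)
open import Relation.Binary.Core using (_⇒_)
open import Relation.Binary.PropositionalEquality
open import Relation.Nullary using (¬_)
open import Relation.Nullary.Decidable using (from-yes)

open +-*-Solver using (solve; con; _:+_; _:*_; _:-_; :-_; _:=_)

p≤∣p∣ : ∀ p → p ℚ.≤ ℚ.∣ p ∣
p≤∣p∣ p with ℚₚ.≤-total 0ℚ p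
... | inj₁ 0≤p = ℚₚ.≤-reflexive (sym (ℚₚ.0≤p⇒∣p∣≡p 0≤p))
... | inj₂ p≤0 = ℚₚ.≤-trans p≤0 (ℚₚ.0≤∣p∣ p)

∣p-q∣≤r⇒p≤q+r : ∀ p q {r} → ℚ.∣ p ℚ.- q ∣ ℚ.≤ r → p ℚ.≤ q ℚ.+ r
∣p-q∣≤r⇒p≤q+r p q {r} ∣p-q∣≤r = begin
  p               ≡⟨ solve 2 (λ p q → p := q :+ (p :- q)) refl p q ⟩
  q ℚ.+ (p ℚ.- q) ≤⟨ ℚₚ.+-monoʳ-≤ q (ℚₚ.≤-trans (p≤∣p∣ (p ℚ.- q)) ∣p-q∣≤r) ⟩
  q ℚ.+ r         ∎
  where open ℚₚ.≤-Reasoning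

∣p-q∣≡∣q-p∣ : ∀ p q → ℚ.∣ p ℚ.- q ∣ ≡ ℚ.∣ q ℚ.- p ∣
∣p-q∣≡∣q-p∣ p q = trans (sym (ℚₚ.∣-p∣≡∣p∣ (p ℚ.- q)))
  (cong ℚ.∣_∣ (solve 2 (λ p q → :- (p :- q) := q :- p) refl p q))

∣p-q∣≤r⇒q-r≤p : ∀ p q {r} → ℚ.∣ p ℚ.- q ∣ ℚ.≤ r → q ℚ.- r ℚ.≤ p
∣p-q∣≤r⇒q-r≤p p q {r} ∣p-q∣≤r = begin
  q ℚ.- r         ≤⟨ ℚₚ.+-monoˡ-≤ (ℚ.- r) (∣p-q∣≤r⇒p≤q+r q p (subst (ℚ._≤ r) (∣p-q∣≡∣q-p∣ p q) ∣p-q∣≤r)) ⟩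
  (p ℚ.+ r) ℚ.- r ≡⟨ solve 2 (λ p r → (p :+ r) :- r := p) refl p r ⟩
  p               ∎
  where open ℚₚ.≤-Reasoning

∣p-r∣≤∣p-q∣+∣q-r∣ : ∀ p q r → ℚ.∣ p ℚ.- r ∣ ℚ.≤ ℚ.∣ p ℚ.- q ∣ ℚ.+ ℚ.∣ q ℚ.- r ∣
∣p-r∣≤∣p-q∣+∣q-r∣ p q r = subst (λ z → ℚ.∣ z ∣ ℚ.≤ ℚ.∣ p ℚ.- q ∣ ℚ.+ ℚ.∣ q ℚ.- r ∣)
  (solve 3 (λ p q r → (p :- q) :+ (q :- r) := p :- r) refl p q r)
  (ℚₚ.∣p+q∣≤∣p∣+∣q∣ (p ℚ.- q) (q ℚ.- r))

-- A term of `x ÷ y [ y#0 ]` unfolds to `p ℚ.* recip q`; this is how its denominator is cleared.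
q*[p*recip-q]≡p : ∀ p {q} → 0ℚ ℚ.< q → q ℚ.* (p ℚ.* recip q) ≡ p
q*[p*recip-q]≡p p {q} 0<q = begin
  q ℚ.* (p ℚ.* recip q) ≡⟨ solve 3 (λ p q r → q :* (p :* r) := p :* (q :* r)) refl p q (recip q) ⟩
  p ℚ.* (q ℚ.* recip q) ≡⟨ cong (p ℚ.*_) (recip-inverse (ℚₚ.<⇒≢ 0<q ∘ sym)) ⟩
  p ℚ.* 1ℚ              ≡⟨ ℚₚ.*-identityʳ p ⟩
  p                     ∎
  where open ≡-Reasoning

*-monoʳ-≤-0< : ∀ {p q r} → 0ℚ ℚ.< r → p ℚ.≤ q → r ℚ.* p ℚ.≤ r ℚ.* q
*-monoʳ-≤-0< {r = r} 0<r = ℚₚ.*-monoˡ-≤-nonNeg r {{ℚ.nonNegative (ℚₚ.<⇒≤ 0<r)}}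

p<p+q : ∀ p {q} → 0ℚ ℚ.< q → p ℚ.< p ℚ.+ q
p<p+q p {q} 0<q = subst (ℚ._< p ℚ.+ q) (ℚₚ.+-identityʳ p) (ℚₚ.+-monoʳ-< p 0<q)

-- Each late term of a real inequality `_<_` comes with a gap; trading the gap for strictness turns
-- it into a strict inequality of rationals.
p+q≤r⇒p<r : ∀ p {q r} → 0ℚ ℚ.< q → p ℚ.+ q ℚ.≤ r → p ℚ.< r
p+q≤r⇒p<r p 0<q = ℚₚ.<-≤-trans (p<p+q p 0<q)

0<p⇒0<½p : ∀ {p} → 0ℚ ℚ.< p → 0ℚ ℚ.< ½ ℚ.* p
0<p⇒0<½p {p} 0<p = ℚₚ.positive⁻¹ (½ ℚ.* p) {{ℚₚ.pos*pos⇒pos ½ p {{ℚ.positive 0<p}}}}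

-- The definition of `_≤_` lets the index depend on `ε`; here one index serves every `ε`, so real
-- inequalities can be checked term by term.
eventually-≤ : ∀ x y N → (∀ n → N ℕ.≤ n → seq x n ℚ.≤ seq y n) → x ≤ y
eventually-≤ x y N x≤y ε 0<ε = N , λ n N≤n → ℚₚ.≤-trans (x≤y n N≤n) (ℚₚ.<⇒≤ (p<p+q (seq y n) 0<ε))

0<fromℚ : ∀ {q} → 0ℚ ℚ.< q → 0ℝ < fromℚ q
0<fromℚ {q} 0<q = q , 0<q , 0 , λ _ _ → ℚₚ.≤-reflexive (ℚₚ.+-identityˡ q)

-- Far enough out, the terms of `y` are positive, so multiplying the two-sided bound on the
-- quotient's terms by them keeps its direction. Apartness `y#0` alone would also allow negative
-- `y`, which reverses it.
quotient-bounds : ∀ x y K ε (y#0 : y # 0ℝ) → 0ℝ < y → ∣ x ÷ y [ y#0 ] - K ∣ < ε →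
  y * (K - ε) ≤ x × x ≤ y * (K + ε)
quotient-bounds x y K ε y#0 (γ , 0<γ , M , γ≤y) (δ , 0<δ , N , close) =
  eventually-≤ (y * (K - ε)) x (M ℕ.⊔ N) (λ m h →
    subst (seq y m ℚ.* (seq K m ℚ.- seq ε m) ℚ.≤_) (q*[p*recip-q]≡p (seq x m) (y>0 m h))
      (*-monoʳ-≤-0< (y>0 m h) (∣p-q∣≤r⇒q-r≤p _ (seq K m) (within m h)))) ,
  eventually-≤ x (y * (K + ε)) (M ℕ.⊔ N) (λ m h →
    subst (ℚ._≤ seq y m ℚ.* (seq K m ℚ.+ seq ε m)) (q*[p*recip-q]≡p (seq x m) (y>0 m h))
      (*-monoʳ-≤-0< (y>0 m h) (∣p-q∣≤r⇒p≤q+r _ (seq K m) (within m h))))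
  where
  y>0 : ∀ m → M ℕ.⊔ N ℕ.≤ m → 0ℚ ℚ.< seq y m
  y>0 m h = p+q≤r⇒p<r 0ℚ 0<γ (γ≤y m (ℕₚ.m⊔n≤o⇒m≤o M N h))

  within : ∀ m → M ℕ.⊔ N ℕ.≤ m →
    ℚ.∣ seq x m ℚ.* recip (seq y m) ℚ.- seq K m ∣ ℚ.≤ seq ε m
  within m h = ℚₚ.<⇒≤ (p+q≤r⇒p<r _ 0<δ (close m (ℕₚ.m⊔n≤o⇒n≤o M N h)))

almost⇒Θ : ∀ f g → EventuallyPositive g → ∀ K → f ∈a[ K , g ] → f ∈Θ[ g ]
almost⇒Θ f g (n₁ , g>0) K ((δ , 0<δ , N , δ≤K) , lim)
  with lim (fromℚ (½ ℚ.* δ)) (0<fromℚ (0<p⇒0<½p 0<δ))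
... | n₀ , close =
  -- The same `½δ` is the tolerance and the gap witnessing that both constants are positive.
  K - ε , (½δ , 0<½δ , N , lower) ,
  K + ε , (½δ , 0<½δ , N , upper) ,
  n₀ ℕ.⊔ n₁ , λ n n>n₀⊔n₁ →
    let gₙ#0 , near = close n (ℕₚ.m⊔n<o⇒m<o n₀ n₁ n>n₀⊔n₁)
    in quotient-bounds (f n) (g n) K ε gₙ#0 (g>0 n (ℕₚ.m⊔n<o⇒n<o n₀ n₁ n>n₀⊔n₁)) near
  where
  ½δ = ½ ℚ.* δ
  ε = fromℚ ½δ

  0<½δ = 0<p⇒0<½p 0<δ

  lower : ∀ m → N ℕ.≤ m → 0ℚ ℚ.+ ½δ ℚ.≤ seq K m ℚ.- ½δ
  lower m N≤m = begin
    -- The summand `0ℚ` is the term of `0ℝ` in the unfolded `_<_`; keeping it lets `δ≤K` apply as it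
    -- stands.
    0ℚ ℚ.+ ½δ        ≡⟨ solve 1 (λ d → con 0ℚ :+ con ½ :* d := (con 0ℚ :+ d) :- con ½ :* d) refl δ ⟩
    (0ℚ ℚ.+ δ) ℚ.- ½δ ≤⟨ ℚₚ.+-monoˡ-≤ (ℚ.- ½δ) (δ≤K m N≤m) ⟩
    seq K m ℚ.- ½δ   ∎
    where open ℚₚ.≤-Reasoning

  upper : ∀ m → N ℕ.≤ m → 0ℚ ℚ.+ ½δ ℚ.≤ seq K m ℚ.+ ½δ
  upper m N≤m = ℚₚ.+-monoˡ-≤ ½δ (ℚₚ.<⇒≤ (p+q≤r⇒p<r 0ℚ 0<δ (δ≤K m N≤m)))

2ℚ : ℚ
2ℚ = 1ℚ ℚ.+ 1ℚ

alternating : ℕ → ℚ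
alternating 0             = 1ℚ
alternating 1             = 2ℚ
alternating (suc (suc n)) = alternating n

1≤alternating : ∀ n → 1ℚ ℚ.≤ alternating n
1≤alternating 0             = ℚₚ.≤-refl
1≤alternating 1             = from-yes (1ℚ ℚₚ.≤? 2ℚ)
1≤alternating (suc (suc n)) = 1≤alternating n

alternating≤2 : ∀ n → alternating n ℚ.≤ 2ℚ
alternating≤2 0             = from-yes (1ℚ ℚₚ.≤? 2ℚ)
alternating≤2 1             = ℚₚ.≤-refl
alternating≤2 (suc (suc n)) = alternating≤2 n

alternating-jump : ∀ n → ℚ.∣ alternating n ℚ.- alternating (suc n) ∣ ≡ 1ℚ
alternating-jump 0             = refl
alternating-jump 1             = refl
alternating-jump (suc (suc n)) = alternating-jump n

alternatingℝ onesℝ : ℕ → ℝ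
alternatingℝ n = fromℚ (alternating n)
onesℝ _ = fromℚ 1ℚ

0<1ℚ : 0ℚ ℚ.< 1ℚ
0<1ℚ = ℚₚ.positive⁻¹ 1ℚ

alternatingℝ∈Θ[onesℝ] : alternatingℝ ∈Θ[ onesℝ ]
alternatingℝ∈Θ[onesℝ] = fromℚ 1ℚ , 0<fromℚ 0<1ℚ , fromℚ 2ℚ , 0<fromℚ (ℚₚ.positive⁻¹ 2ℚ) , 0 , λ n _ →
  -- The terms of the products evaluate to 1 and 2, so the bounds on `alternating` fit directly.
  eventually-≤ (onesℝ n * fromℚ 1ℚ) (alternatingℝ n) 0 (λ _ _ → 1≤alternating n) ,
  eventually-≤ (alternatingℝ n) (onesℝ n * fromℚ 2ℚ) 0 (λ _ _ → alternating≤2 n)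

alternatingℝ∉a[K,onesℝ] : ¬ (∃[ K ] alternatingℝ ∈a[ K , onesℝ ])
alternatingℝ∉a[K,onesℝ] (K , _ , lim) with lim (fromℚ ½) (0<fromℚ (ℚₚ.positive⁻¹ ½))
... | n₀ , close
  with close (suc n₀) ℕₚ.≤-refl | close (suc (suc n₀)) (ℕₚ.n≤1+n (suc n₀))
... | _ , δ , 0<δ , M , near | _ , δ′ , 0<δ′ , N , near′ = ℚₚ.<-irrefl refl (begin-strict
  1ℚ                                  ≡⟨ alternating-jump (suc n₀) ⟨
  ℚ.∣ p ℚ.- q ∣                       ≤⟨ ∣p-r∣≤∣p-q∣+∣q-r∣ p k q ⟩
  ℚ.∣ p ℚ.- k ∣ ℚ.+ ℚ.∣ k ℚ.- q ∣     ≡⟨ cong (ℚ.∣ p ℚ.- k ∣ ℚ.+_) (∣p-q∣≡∣q-p∣ k q) ⟩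
  -- Two tolerances of 1/2 add up to exactly the jump, so the contradiction rests on strictness
  -- here.
  ℚ.∣ p ℚ.- k ∣ ℚ.+ ℚ.∣ q ℚ.- k ∣     <⟨ ℚₚ.+-mono-< (close⇒< p 0<δ (near m (ℕₚ.m≤m⊔n M N)))
                                                     (close⇒< q 0<δ′ (near′ m (ℕₚ.m≤n⊔m M N))) ⟩
  ½ ℚ.+ ½                             ≡⟨⟩
  1ℚ                                  ∎)
  where
  open ℚₚ.≤-Reasoning
  -- This indexes the rational approximations, not the sequence `alternatingℝ`: at a common `m`, the
  -- same rational `k` stands for `K` in both estimates.
  m = M ℕ.⊔ N
  p = alternating (suc n₀)
  q = alternating (suc (suc n₀))
  k = seq K m

  close⇒< : ∀ r {η} → 0ℚ ℚ.< η → ℚ.∣ r ℚ.* recip 1ℚ ℚ.- k ∣ ℚ.+ η ℚ.≤ ½ → ℚ.∣ r ℚ.- k ∣ ℚ.< ½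
  -- `recip 1ℚ` evaluates to `1ℚ`, so the quotient's term is `r ℚ.* 1ℚ`.
  close⇒< r 0<η close = subst (λ z → ℚ.∣ z ℚ.- k ∣ ℚ.< ½) (ℚₚ.*-identityʳ r) (p+q≤r⇒p<r _ 0<η close)

theorem3p3 : (∀ (f g : ℕ → ℝ) → EventuallyPositive g → ∀ (K : ℝ) → f ∈a[ K , g ] → f ∈Θ[ g ])
    × (∃[ f ] ∃[ g ] EventuallyPositive g × f ∈Θ[ g ] × ¬ (∃[ K ] f ∈a[ K , g ]))
    × (Almost ⇒ BigTheta)
theorem3p3 =
  almost⇒Θ ,
  (alternatingℝ , onesℝ , (0 , λ _ _ → 0<fromℚ 0<1ℚ) , alternatingℝ∈Θ[onesℝ] , alternatingℝ∉a[K,onesℝ]) ,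
  -- Positivity comes bundled with the comparison function, and `K` is the witness hidden in
  -- `Almost`.
  λ { {f} {g , g>0} (K , f∈a) → almost⇒Θ f g g>0 K f∈a }
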